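{- The complete bipartite graph $K_{2,3}$ is not the (slide) $\gamma$-graph of any bipartite graph. That is, there is no bipartite graph $G$ such that the graph $\mathcal{S}(G,\gamma)$ is isomorphic to $K_{2,3}$.
   Context: Graphs are finite, simple and undirected (and $G$ is not assumed connected). For a graph $G$ and a vertex $v$, $N(v)$ is the set of vertices adjacent to $v$ and $N[v]=N(v)\cup\{v\}$; for a set $S$ of vertices, $N[S]=\bigcup_{x\in S}N[x]$. A set $D\subseteq V(G)$ is a dominating set of $G$ if $N[D]=V(G)$. The domination number $\gamma(G)$ is the minimum cardinality of a dominating set of $G$, and a $\gamma$-set of $G$ is a dominating set of cardinality $\gamma(G)$. The slide $\gamma$-graph $\mathcal{S}(G,\gamma)$ (also denoted $G(\gamma)$, and called simply the $\gamma$-graph of $G$) is the graph whose vertices are the $\gamma$-sets of $G$, where two $\gamma$-sets $D_1$ and $D_2$ are adjacent if and only if there exist vertices $x\in D_1$ and $y\in D_2$ that are adjacent in $G$ and satisfy $D_1\setminus\{x\}=D_2\setminus\{y\}$. $K_{2,3}$ denotes the complete bipartite graph with parts of sizes $2$ and $3$. -}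

module Defs where

open import Data.Bool.Base using (Bool)
open import Data.Empty using (⊥)
open import Data.Fin.Base using (Fin)
open import Data.Fin.Properties using (all?; any?) renaming (_≟_ to _≟ᶠ_)
open import Data.Fin.Subset using (Subset; _∈_; _-_; ∣_∣) renaming (⊤ to full)
open import Data.Fin.Subset.Properties
  using (_∈?_; ∈⊤; anySubset?; x∈p∧x≢y⇒x∈p-y; x∈p⇒p-x⊂p)
open import Data.Nat.Base using (ℕ; zero; suc; _≤_; z≤n; s≤s)
import Data.Nat.Properties as ℕ
open import Data.Product.Base using (∃; ∃₂; _×_; _,_; proj₁; proj₂)
open import Data.Refinement using (Refinement-syntax; value)
open import Data.Sum.Base using (_⊎_; inj₁; inj₂)
open import Data.Unit.Base using (⊤; tt)
open import Data.Bool.Properties using () renaming (_≟_ to _≟ᵇ_)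
open import Data.Vec.Properties using (≡-dec)
open import Function.Base using (_∘_)
open import Function.Bundles using (_↔_; _⇔_; module Inverse)
open import Level using (0ℓ)
open import Relation.Binary.Core using (Rel)
open import Relation.Binary.Definitions as B using (Symmetric; Irreflexive)
open import Relation.Binary.PropositionalEquality.Core
  using (_≡_; _≢_; refl; sym; subst)
open import Relation.Nullary using (¬_; Dec; yes; no; contradiction)
open import Relation.Nullary.Decidable using (_×-dec_; _⊎-dec_)
open import Relation.Unary using (Pred; Decidable; _∪_; ｛_｝)

record Graph (V : Set) : Set₁ where
  infix 4 _~_ _~?_
  field
    _~_      : Rel V 0ℓ
    ~-sym    : Symmetric _~_
    ~-irrefl : Irreflexive _≡_ _~_
    _~?_     : B.Decidable _~_

infix 4 _≅_
record _≅_ {V W : Set} (G : Graph V) (H : Graph W) : Set where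
  private
    module G = Graph G
    module H = Graph H
  field
    bijection : V ↔ W
  open Inverse bijection public using (to; from)
  field
    adjacency : ∀ {u v} → u G.~ v ⇔ to u H.~ to v

Bipartite : {V : Set} → Graph V → Set
Bipartite {V} G = ∃ λ (side : V → Bool) → ∀ {u v} → u ~ v → side u ≢ side v
  where open Graph G

K : (m n : ℕ) → Graph (Fin m ⊎ Fin n)
K m n = record
  { _~_      = _~_
  ; ~-sym    = λ {u} {v} → ~-sym u v
  ; ~-irrefl = λ {u} → λ { refl → ~-irrefl u }
  ; _~?_     = _~?_
  }
  where
  _~_ : Rel (Fin m ⊎ Fin n) 0ℓ
  inj₁ _ ~ inj₁ _ = ⊥
  inj₁ _ ~ inj₂ _ = ⊤
  inj₂ _ ~ inj₁ _ = ⊤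
  inj₂ _ ~ inj₂ _ = ⊥

  ~-sym : ∀ u v → u ~ v → v ~ u
  ~-sym (inj₁ _) (inj₂ _) _ = tt
  ~-sym (inj₂ _) (inj₁ _) _ = tt

  ~-irrefl : ∀ u → ¬ (u ~ u)
  ~-irrefl (inj₁ _) ()
  ~-irrefl (inj₂ _) ()

  _~?_ : B.Decidable _~_
  inj₁ _ ~? inj₁ _ = no λ ()
  inj₁ _ ~? inj₂ _ = yes tt
  inj₂ _ ~? inj₁ _ = yes tt
  inj₂ _ ~? inj₂ _ = no λ ()

least : {P : Pred ℕ 0ℓ} → Decidable P → ∀ k → P k →
        ∃ λ m → P m × (∀ j → P j → m ≤ j)
least P? k pk with P? 0
least P? k       pk | yes p₀ = 0 , p₀ , λ _ _ → z≤n
least P? zero    pk | no ¬p₀ = contradiction pk ¬p₀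
least P? (suc k) pk | no ¬p₀ with least (P? ∘ suc) k pk
... | m , pm , min = suc m , pm , λ where
  zero    p₀ → contradiction p₀ ¬p₀
  (suc j) pj → s≤s (min j pj)

module _ {n : ℕ} (G : Graph (Fin n)) where
  open Graph G

  openNeighbourhood : Fin n → Pred (Fin n) 0ℓ
  openNeighbourhood v = λ u → v ~ u

  closedNeighbourhood : Fin n → Pred (Fin n) 0ℓ
  closedNeighbourhood v = openNeighbourhood v ∪ ｛ v ｝

  closedNeighbourhoodOf : Subset n → Pred (Fin n) 0ℓ
  closedNeighbourhoodOf S = λ u → ∃ λ x → x ∈ S × closedNeighbourhood x u

  Dominating : Pred (Subset n) 0ℓ
  Dominating D = ∀ v → closedNeighbourhoodOf D v

  dominating? : Decidable Dominating
  dominating? D = all? λ v → any? λ x → (x ∈? D) ×-dec ((x ~? v) ⊎-dec (x ≟ᶠ v))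

  HasDominatingSetOfSize : Pred ℕ 0ℓ
  HasDominatingSetOfSize k = ∃ λ D → Dominating D × ∣ D ∣ ≡ k

  hasDominatingSetOfSize? : Decidable HasDominatingSetOfSize
  hasDominatingSetOfSize? k = anySubset? λ D → dominating? D ×-dec (∣ D ∣ ℕ.≟ k)

  IsDominationNumber : Pred ℕ 0ℓ
  IsDominationNumber k =
    HasDominatingSetOfSize k × (∀ j → HasDominatingSetOfSize j → k ≤ j)

  dominationNumber : ∃ IsDominationNumber
  dominationNumber = least hasDominatingSetOfSize? ∣ full {n} ∣
    (full , (λ v → v , ∈⊤ , inj₂ refl) , refl)

  γ : ℕ
  γ = proj₁ dominationNumber

  γ-isDominationNumber : IsDominationNumber γ
  γ-isDominationNumber = proj₂ dominationNumber

  IsγSet : Pred (Subset n) 0ℓ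
  IsγSet D = Dominating D × ∣ D ∣ ≡ γ

  isγSet? : Decidable IsγSet
  isγSet? D = dominating? D ×-dec (∣ D ∣ ℕ.≟ γ)

  -- The membership proof is irrelevant, so that γ-sets are equal exactly when
  -- they have the same elements; it can be recomputed using isγSet?.
  γSet : Set
  γSet = [ D ∈ Subset n ∣ IsγSet D ]

  Slide : Rel (Subset n) 0ℓ
  Slide D₁ D₂ = ∃₂ λ x y → x ∈ D₁ × y ∈ D₂ × x ~ y × D₁ - x ≡ D₂ - y

  slide-sym : Symmetric Slide
  slide-sym (x , y , x∈D₁ , y∈D₂ , x~y , eq) =
    y , x , y∈D₂ , x∈D₁ , ~-sym x~y , sym eq

  slide-irrefl : ∀ D → ¬ Slide D D
  slide-irrefl D (x , y , x∈D , y∈D , x~y , eq) = y∉D-y y∈D-y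
    where
    y∈D-y : y ∈ D - y
    y∈D-y = subst (y ∈_) eq
      (x∈p∧x≢y⇒x∈p-y y∈D λ y≡x → ~-irrefl (sym y≡x) x~y)

    y∉D-y : ¬ (y ∈ D - y)
    y∉D-y y∈ with x∈p⇒p-x⊂p y∈D
    ... | _ , z , z∈D , z∉D-y with z ≟ᶠ y
    ...   | yes refl = z∉D-y y∈
    ...   | no z≢y   = z∉D-y (x∈p∧x≢y⇒x∈p-y z∈D z≢y)

  slide? : B.Decidable Slide
  slide? D₁ D₂ = any? λ x → any? λ y →
    (x ∈? D₁) ×-dec (y ∈? D₂) ×-dec (x ~? y) ×-dec ≡-dec _≟ᵇ_ (D₁ - x) (D₂ - y)

  γ-graph : Graph γSet
  γ-graph = record
    { _~_      = λ D₁ D₂ → Slide (value D₁) (value D₂)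
    ; ~-sym    = slide-sym
    ; ~-irrefl = λ { {D} refl → slide-irrefl (value D) }
    ; _~?_     = λ D₁ D₂ → slide? (value D₁) (value D₂)
    }

{-# OPTIONS --safe #-}
-- Let A and B be the γ-sets forming the part of size 2. A γ-set X adjacent to both
-- is of one of three kinds:
--   over:    B = A − a + b and X = A − a + q with a ~ q ~ b;
--   under:   B = A − a + b and X = A − p + b with a ~ p ~ b;
--   square:  A ∖ B = {a , a′}, B ∖ A = {b , b′} and X = A − a + b with a ~ b, a′ ~ b′.
-- In a triangle-free graph, adjacent x and y satisfy N[x] ∩ N[y] = {x , y}. Hence
-- two distinct X's over A and B would make A − a dominating, and two distinct X's
-- under them would make A − p dominating. So three X's are all squares, and then
-- a, a′, b, b′ induce a 4-cycle, which makes all four sets A − x + y with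
-- x ∈ {a , a′} and y ∈ {b , b′} γ-sets: one too many.
module Submission where

open import Defs
open import Data.Bool using (Bool; true; false)
open import Data.Empty using (⊥)
open import Data.Fin using (Fin; zero; suc; quotient; remainder; combine)
open import Data.Fin.Properties
  using (_≟_; <⇒≢; pigeonhole; combine-remQuot)
open import Data.Fin.Subset using (Subset; inside; outside; _∈_; _∉_; _⊆_; _∪_; _-_; ⁅_⁆; ∣_∣)
open import Data.Fin.Subset.Properties
  using (x∈p∪q⁺; x∈p∪q⁻; p─q⊆p; x∈p∧x≢y⇒x∈p-y; x∈p⇒∣p-x∣<∣p∣;
         x∈⁅x⁆; x∈⁅y⁆⇒x≡y; ∣⁅x⁆∣≡1; ⊆-antisym)
open import Data.Irrelevant using ([_])
open import Data.Nat using (ℕ; suc; _+_; _≤_; z≤n; s≤s)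
open import Data.Nat.Properties as ℕ using (module ≤-Reasoning)
open import Data.Product using (∃; _×_; _,_; proj₁; proj₂)
open import Data.Product.Properties using (×-≡,≡→≡)
open import Data.Refinement using (value; _,_)
open import Data.Sum using (_⊎_; inj₁; inj₂)
open import Data.Sum.Properties using (inj₂-injective)
open import Data.Unit using (tt)
open import Data.Vec using ([]; _∷_; there)
open import Function using (_∘_; Injective; Inverse; Equivalence)
open import Relation.Binary.PropositionalEquality
  using (_≡_; _≢_; refl; sym; trans; cong; subst; subst₂; ≢-sym)
open import Relation.Nullary using (¬_; yes; no; contradiction; recompute)

private
  variable
    n : ℕ
    D E A B X Y : Subset n
    a a′ b b′ c c′ x x′ y y′ z : Fin n

-- Removing and exchanging single elements of a subset.

x∉p-x : ∀ (p : Subset n) x → x ∉ p - x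
x∉p-x (s ∷ p) zero    ()
x∉p-x (s ∷ p) (suc x) (there x∈) = x∉p-x p x x∈

∣p∪q∣≤∣p∣+∣q∣ : ∀ (p q : Subset n) → ∣ p ∪ q ∣ ≤ ∣ p ∣ + ∣ q ∣
∣p∪q∣≤∣p∣+∣q∣ []            []            = z≤n
∣p∪q∣≤∣p∣+∣q∣ (outside ∷ p) (outside ∷ q) = ∣p∪q∣≤∣p∣+∣q∣ p q
∣p∪q∣≤∣p∣+∣q∣ (outside ∷ p) (inside  ∷ q) =
  subst (suc ∣ p ∪ q ∣ ≤_) (sym (ℕ.+-suc ∣ p ∣ ∣ q ∣)) (s≤s (∣p∪q∣≤∣p∣+∣q∣ p q))
∣p∪q∣≤∣p∣+∣q∣ (inside  ∷ p) (outside ∷ q) = s≤s (∣p∪q∣≤∣p∣+∣q∣ p q)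
∣p∪q∣≤∣p∣+∣q∣ (inside  ∷ p) (inside  ∷ q) =
  s≤s (ℕ.≤-trans (∣p∪q∣≤∣p∣+∣q∣ p q) (ℕ.+-monoʳ-≤ ∣ p ∣ (ℕ.n≤1+n ∣ q ∣)))

infix 8 _[_↦_]
_[_↦_] : Subset n → Fin n → Fin n → Subset n
D [ x ↦ y ] = (D - x) ∪ ⁅ y ⁆

new∈ : ∀ (D : Subset n) x y → y ∈ D [ x ↦ y ]
new∈ D x y = x∈p∪q⁺ (inj₂ (x∈⁅x⁆ y))

old∈ : z ∈ D → z ≢ x → z ∈ D [ x ↦ y ]
old∈ z∈D z≢x = x∈p∪q⁺ (inj₁ (x∈p∧x≢y⇒x∈p-y z∈D z≢x))

exchange⁻ : ∀ (D : Subset n) x y → z ∈ D [ x ↦ y ] → z ≡ y ⊎ z ∈ D - x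
exchange⁻ D x y z∈ with x∈p∪q⁻ (D - x) ⁅ y ⁆ z∈
... | inj₁ z∈D-x = inj₂ z∈D-x
... | inj₂ z∈⁅y⁆ = inj₁ (x∈⁅y⁆⇒x≡y y z∈⁅y⁆)

-⇒∈ : ∀ (D : Subset n) x → z ∈ D - x → z ∈ D
-⇒∈ D x = p─q⊆p D ⁅ x ⁆

-⇒≢ : ∀ (D : Subset n) x → z ∈ D - x → z ≢ x
-⇒≢ D x z∈ refl = x∉p-x D x z∈

exchange⇒∈ : ∀ (D : Subset n) x y → z ∈ D [ x ↦ y ] → z ≢ y → z ∈ D
exchange⇒∈ D x y z∈ z≢y with exchange⁻ D x y z∈
... | inj₁ z≡y = contradiction z≡y z≢y
... | inj₂ z∈- = -⇒∈ D x z∈-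

old∉ : ∀ (D : Subset n) x y → x ≢ y → x ∉ D [ x ↦ y ]
old∉ D x y x≢y x∈ with exchange⁻ D x y x∈
... | inj₁ x≡y = x≢y x≡y
... | inj₂ x∈- = x∉p-x D x x∈-

∈∧∉⇒≢ : x ∈ D → y ∉ D → x ≢ y
∈∧∉⇒≢ x∈D y∉D refl = y∉D x∈D

-- `x` is the only element of `D` that the exchange loses, and `y` the only one it gains.
exchange-injective : x ∈ D → y ∉ D → x′ ∈ D → y′ ∉ D →
                     D [ x ↦ y ] ≡ D [ x′ ↦ y′ ] → x ≡ x′ × y ≡ y′
exchange-injective {x = x} {D = D} {y = y} {x′ = x′} {y′ = y′} x∈D y∉D x′∈D y′∉D eq =
  same-x , same-y
  where
  same-x : x ≡ x′
  same-x with x ≟ x′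
  ... | yes x≡x′ = x≡x′
  ... | no  x≢x′ = contradiction (subst (x ∈_) (sym eq) (old∈ x∈D x≢x′))
                                 (old∉ D x y (∈∧∉⇒≢ x∈D y∉D))

  same-y : y ≡ y′
  same-y with exchange⁻ D x′ y′ (subst (y ∈_) eq (new∈ D x y))
  ... | inj₁ y≡y′ = y≡y′
  ... | inj₂ y∈-  = contradiction (-⇒∈ D x′ y∈-) y∉D

-- Only an upper bound: if `y` already lies in `D` and differs from `x`, the exchange merely deletes
-- `x`. For dominating sets, minimality of `γ` supplies the other inequality.
∣exchange∣≤ : x ∈ D → ∣ D [ x ↦ y ] ∣ ≤ ∣ D ∣
∣exchange∣≤ {x = x} {D = D} {y = y} x∈D = begin
  ∣ D [ x ↦ y ] ∣        ≤⟨ ∣p∪q∣≤∣p∣+∣q∣ (D - x) ⁅ y ⁆ ⟩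
  ∣ D - x ∣ + ∣ ⁅ y ⁆ ∣  ≡⟨ cong (∣ D - x ∣ +_) (∣⁅x⁆∣≡1 y) ⟩
  ∣ D - x ∣ + 1          ≡⟨ ℕ.+-comm ∣ D - x ∣ 1 ⟩
  suc ∣ D - x ∣          ≤⟨ x∈p⇒∣p-x∣<∣p∣ x∈D ⟩
  ∣ D ∣                  ∎
  where open ≤-Reasoning

reinsert : y ∈ E → E ≡ E [ y ↦ y ]
reinsert {y = y} {E = E} y∈E = ⊆-antisym ⊆₁ ⊆₂
  where
  ⊆₁ : E ⊆ E [ y ↦ y ]
  ⊆₁ {z} z∈E with z ≟ y
  ... | yes refl = new∈ E y y
  ... | no  z≢y  = old∈ z∈E z≢y

  ⊆₂ : E [ y ↦ y ] ⊆ E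
  ⊆₂ z∈ with exchange⁻ E y y z∈
  ... | inj₁ refl = y∈E
  ... | inj₂ z∈-  = -⇒∈ E y z∈-

-- Turns the symmetric equation in `Slide` into an explicit formula for the second set in terms of
-- the first.
common⇒exchange : y ∈ E → D - x ≡ E - y → E ≡ D [ x ↦ y ]
common⇒exchange {y = y} y∈E eq = trans (reinsert y∈E) (cong (_∪ ⁅ y ⁆) (sym eq))

common⇒∉ : x ≢ y → D - x ≡ E - y → y ∉ D
common⇒∉ {y = y} {E = E} x≢y eq y∈D =
  x∉p-x E y (subst (y ∈_) eq (x∈p∧x≢y⇒x∈p-y y∈D (≢-sym x≢y)))

-- The second exchange puts `p` back, so only `r` is lost; `r ≢ q` ensures that the new element `q`
-- survives it.
exchange-undo : ∀ {p q r : Fin n} → p ∈ D → r ≢ q → r ≢ p →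
                D [ p ↦ q ] [ r ↦ p ] ≡ D [ r ↦ q ]
exchange-undo {D = D} {p} {q} {r} p∈D r≢q r≢p = ⊆-antisym ⊆₁ ⊆₂
  where
  ⊆₁ : D [ p ↦ q ] [ r ↦ p ] ⊆ D [ r ↦ q ]
  ⊆₁ z∈ with exchange⁻ (D [ p ↦ q ]) r p z∈
  ... | inj₁ refl = old∈ p∈D (≢-sym r≢p)
  ... | inj₂ z∈- with exchange⁻ D p q (-⇒∈ (D [ p ↦ q ]) r z∈-)
  ...   | inj₁ refl = new∈ D r q
  ...   | inj₂ z∈D- = old∈ (-⇒∈ D p z∈D-) (-⇒≢ (D [ p ↦ q ]) r z∈-)

  ⊆₂ : D [ r ↦ q ] ⊆ D [ p ↦ q ] [ r ↦ p ]
  ⊆₂ {z} z∈ with exchange⁻ D r q z∈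
  ... | inj₁ refl = old∈ (new∈ D p q) (≢-sym r≢q)
  ... | inj₂ z∈- with z ≟ p
  ...   | yes refl = new∈ (D [ p ↦ q ]) r p
  ...   | no  z≢p  = old∈ (old∈ (-⇒∈ D r z∈-) z≢p) (-⇒≢ D r z∈-)

-- Sets that differ in two elements or in one.

record Difference₂ (A B : Subset n) (a a′ : Fin n) : Set where
  field
    a∈A   : a ∈ A
    a∉B   : a ∉ B
    a′∈A  : a′ ∈ A
    a′∉B  : a′ ∉ B
    a≢a′  : a ≢ a′
    cover : ∀ {z} → z ∈ A → z ≡ a ⊎ z ≡ a′ ⊎ z ∈ B

open Difference₂

flip₂ : Difference₂ A B a a′ → Difference₂ A B a′ a
flip₂ d .a∈A = d .a′∈A
flip₂ d .a∉B = d .a′∉B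
flip₂ d .a′∈A = d .a∈A
flip₂ d .a′∉B = d .a∉B
flip₂ d .a≢a′ = ≢-sym (d .a≢a′)
flip₂ d .cover z∈A with d .cover z∈A
... | inj₁ z≡a         = inj₂ (inj₁ z≡a)
... | inj₂ (inj₁ z≡a′) = inj₁ z≡a′
... | inj₂ (inj₂ z∈B)  = inj₂ (inj₂ z∈B)

difference₂-unique : Difference₂ A B a a′ → Difference₂ A B c c′ →
                     (c ≡ a × c′ ≡ a′) ⊎ (c ≡ a′ × c′ ≡ a)
difference₂-unique d e with d .cover (e .a∈A) | d .cover (e .a′∈A)
... | inj₂ (inj₂ c∈B)  | _                 = contradiction c∈B (e .a∉B)
... | _                | inj₂ (inj₂ c′∈B)  = contradiction c′∈B (e .a′∉B)
... | inj₁ refl        | inj₁ refl         = contradiction refl (e .a≢a′)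
... | inj₁ c≡a         | inj₂ (inj₁ c′≡a′) = inj₁ (c≡a , c′≡a′)
... | inj₂ (inj₁ c≡a′) | inj₁ c′≡a         = inj₂ (c≡a′ , c′≡a)
... | inj₂ (inj₁ refl) | inj₂ (inj₁ refl)  = contradiction refl (e .a≢a′)

-- The conditions `old` and `new` make `a` and `b` recoverable from `A` and `B`.
record Replacement (A B : Subset n) (a b : Fin n) : Set where
  field
    old  : a ∈ A
    new  : b ∉ A
    swap : B ≡ A [ a ↦ b ]

replacement-unique : ∀ {d} → Replacement A B a b → Replacement A B c d → a ≡ c × b ≡ d
replacement-unique r s =
  exchange-injective (r .old) (r .new) (s .old) (s .new) (trans (sym (r .swap)) (s .swap))
  where open Replacement

-- A replacement loses a single element of `A`. This separates squares from the other two kinds.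
¬replacement×difference₂ : Replacement A B a b → ¬ Difference₂ A B c c′
¬replacement×difference₂ {A = A} {a = a} {b = b}
  record { old = old ; new = new ; swap = refl } d =
  d .a≢a′ (trans (removed (d .a∈A) (d .a∉B)) (sym (removed (d .a′∈A) (d .a′∉B))))
  where
  removed : z ∈ A → z ∉ A [ a ↦ b ] → z ≡ a
  removed {z} z∈A z∉B with z ≟ a
  ... | yes z≡a = z≡a
  ... | no  z≢a = contradiction (old∈ z∈A z≢a) z∉B

pair : ∀ {C : Set} → C → C → Fin 2 → C
pair c d zero       = c
pair c d (suc zero) = d

pair-injective : ∀ {C : Set} {c d : C} → c ≢ d → Injective _≡_ _≡_ (pair c d)
pair-injective c≢d {zero}     {zero}     eq = refl
pair-injective c≢d {zero}     {suc zero} eq = contradiction eq c≢d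
pair-injective c≢d {suc zero} {zero}     eq = contradiction (sym eq) c≢d
pair-injective c≢d {suc zero} {suc zero} eq = refl

-- Triangle-free graphs.

TriangleFree : ∀ {V : Set} → Graph V → Set
TriangleFree G = ∀ {u v w} → u ~ v → v ~ w → ¬ (u ~ w)
  where open Graph G

bipartite⇒triangleFree : ∀ {V : Set} (G : Graph V) → Bipartite G → TriangleFree G
bipartite⇒triangleFree G (side , proper) {u} {v} {w} u~v v~w u~w =
  ¬three (side u) (side v) (side w) (proper u~v) (proper v~w) (proper u~w)
  where
  ¬three : ∀ (p q r : Bool) → p ≢ q → q ≢ r → ¬ (p ≢ r)
  ¬three true  true  _     p≢q _   _   = p≢q refl
  ¬three false false _     p≢q _   _   = p≢q refl
  ¬three _     true  true  _   q≢r _   = q≢r refl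
  ¬three _     false false _   q≢r _   = q≢r refl
  ¬three true  _     true  _   _   p≢r = p≢r refl
  ¬three false _     false _   _   p≢r = p≢r refl

module _ {n : ℕ} (G : Graph (Fin n)) where
  open Graph G

  -- The shapes of two consecutive slides.

  data Between (A B X : Subset n) : Set where
    over   : ∀ {a b q} → Replacement A B a b → Replacement A X a q →
             a ~ q → q ~ b → Between A B X
    under  : ∀ {a b p} → Replacement A B a b → Replacement A X p b →
             a ~ p → p ~ b → p ≢ a → Between A B X
    square : ∀ {a a′ b b′} → Difference₂ A B a a′ → Difference₂ B A b b′ →
             X ≡ A [ a ↦ b ] → a ~ b → a′ ~ b′ → Between A B X

  ~⇒≢ : x ~ y → x ≢ y
  ~⇒≢ x~y x≡y = ~-irrefl x≡y x~y

  -- Let the slides be `p` to `q` and then `r` to `s`. The kind depends on whether the second slide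
  -- moves the vertex just inserted (`q ≡ r`), and if not, whether it fills the vertex just vacated
  -- (`p ≡ s`).
  slides⇒between : A ≢ B → Slide G A X → Slide G X B → Between A B X
  slides⇒between {A = A} {B = B} {X = X} A≢B
    (p , q , p∈A , q∈X , p~q , A-p≡X-q) (r , s , r∈X , s∈B , r~s , X-r≡B-s)
    with q ≟ r
  ... | yes refl = over
    (record { old = p∈A ; new = common⇒∉ p≢s A-p≡B-s
            ; swap = common⇒exchange s∈B A-p≡B-s })
    (record { old = p∈A ; new = common⇒∉ (~⇒≢ p~q) A-p≡X-q
            ; swap = common⇒exchange q∈X A-p≡X-q })
    p~q r~s
    where
    A-p≡B-s : A - p ≡ B - s
    A-p≡B-s = trans A-p≡X-q X-r≡B-s

    -- Otherwise the second slide would undo the first and give `A` again.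
    p≢s : p ≢ s
    p≢s refl = A≢B (trans (reinsert p∈A) (sym (common⇒exchange s∈B A-p≡B-s)))
  ... | no q≢r = go (common⇒exchange q∈X A-p≡X-q) (common⇒exchange s∈B X-r≡B-s)
    where
    q∉A : q ∉ A
    q∉A = common⇒∉ (~⇒≢ p~q) A-p≡X-q

    s∉X : s ∉ X
    s∉X = common⇒∉ (~⇒≢ r~s) X-r≡B-s

    p∉X : p ∉ X
    p∉X = common⇒∉ (≢-sym (~⇒≢ p~q)) (sym A-p≡X-q)

    r∉B : r ∉ B
    r∉B = common⇒∉ (≢-sym (~⇒≢ r~s)) (sym X-r≡B-s)

    r≢p : r ≢ p
    r≢p = ∈∧∉⇒≢ r∈X p∉X

    go : X ≡ A [ p ↦ q ] → B ≡ X [ r ↦ s ] → Between A B X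
    go refl refl with p ≟ s
    -- The net effect is that `q` replaces `r`, with `p` as the vertex between them.
    ... | yes refl = under
      (record { old = r∈A ; new = q∉A
              ; swap = exchange-undo p∈A (≢-sym q≢r) r≢p })
      (record { old = p∈A ; new = q∉A ; swap = refl })
      r~s p~q (≢-sym r≢p)
      where
      r∈A : r ∈ A
      r∈A = exchange⇒∈ A p q r∈X (≢-sym q≢r)
    ... | no p≢s = square
      (record
        { a∈A  = p∈A
        ; a∉B  = λ p∈B → p∉X (exchange⇒∈ X r s p∈B p≢s)
        ; a′∈A = exchange⇒∈ A p q r∈X (≢-sym q≢r)
        ; a′∉B = r∉B
        ; a≢a′ = ≢-sym r≢p
        ; cover = coverA })
      (record
        { a∈A  = old∈ q∈X q≢r
        ; a∉B  = q∉A
        ; a′∈A = s∈B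
        ; a′∉B = λ s∈A → s∉X (old∈ s∈A (≢-sym p≢s))
        ; a≢a′ = ∈∧∉⇒≢ q∈X s∉X
        ; cover = coverB })
      refl p~q r~s
      where
      coverA : z ∈ A → z ≡ p ⊎ z ≡ r ⊎ z ∈ B
      coverA {z} z∈A with z ≟ p | z ≟ r
      ... | yes z≡p | _       = inj₁ z≡p
      ... | no _    | yes z≡r = inj₂ (inj₁ z≡r)
      ... | no z≢p  | no z≢r  = inj₂ (inj₂ (old∈ (old∈ z∈A z≢p) z≢r))

      coverB : z ∈ B → z ≡ q ⊎ z ≡ s ⊎ z ∈ A
      coverB z∈B with exchange⁻ X r s z∈B
      ... | inj₁ z≡s = inj₂ (inj₁ z≡s)
      ... | inj₂ z∈- with exchange⁻ A p q (-⇒∈ X r z∈-)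
      ...   | inj₁ z≡q  = inj₁ z≡q
      ...   | inj₂ z∈A- = inj₂ (inj₂ (-⇒∈ A p z∈A-))

  -- Domination after removing or exchanging a vertex.

  γSet-minimal : IsγSet G D → x ∈ D → ¬ Dominating G (D - x)
  γSet-minimal {D = D} {x = x} (_ , ∣D∣≡γ) x∈D dom =
    ℕ.<⇒≱ (x∈p⇒∣p-x∣<∣p∣ x∈D)
      (subst (_≤ ∣ D - x ∣) (sym ∣D∣≡γ)
        (proj₂ (γ-isDominationNumber G) ∣ D - x ∣ (D - x , dom , refl)))

  exchange-γSet : IsγSet G D → x ∈ D → Dominating G (D [ x ↦ y ]) →
                  IsγSet G (D [ x ↦ y ])
  exchange-γSet {D = D} {x = x} {y = y} (_ , ∣D∣≡γ) x∈D dom =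
    dom , ℕ.≤-antisym
      (subst (∣ D [ x ↦ y ] ∣ ≤_) ∣D∣≡γ (∣exchange∣≤ x∈D))
      (proj₂ (γ-isDominationNumber G) ∣ D [ x ↦ y ] ∣ (D [ x ↦ y ] , dom , refl))

  dominated-remove : ∀ x {v} → closedNeighbourhoodOf G D v →
                     closedNeighbourhood G x v ⊎ closedNeighbourhoodOf G (D - x) v
  dominated-remove x (c , c∈D , near) with c ≟ x
  ... | yes refl = inj₁ near
  ... | no  c≢x  = inj₂ (c , x∈p∧x≢y⇒x∈p-y c∈D c≢x , near)

  -- Meant for several replacements of the same `x`: a vertex that `A - x` misses is near every
  -- inserted vertex.
  dominated-exchange : ∀ {v} → Replacement A B x y → closedNeighbourhoodOf G B v →
                       closedNeighbourhood G y v ⊎ closedNeighbourhoodOf G (A - x) v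
  dominated-exchange {A = A} {x = x} {y = y}
    record { swap = refl } (c , c∈B , near) with exchange⁻ A x y c∈B
  ... | inj₁ refl = inj₁ near
  ... | inj₂ c∈-  = inj₂ (c , c∈- , near)

  -- Domination in triangle-free graphs.

  module _ (triangleFree : TriangleFree G) where

    -- Any further common vertex `v` would form a triangle with `x` and `y`.
    closedNeighbourhoods∩ : ∀ {v} → x ~ y → closedNeighbourhood G x v →
                            closedNeighbourhood G y v → v ≡ x ⊎ v ≡ y
    closedNeighbourhoods∩ x~y (inj₂ x≡v) _          = inj₁ (sym x≡v)
    closedNeighbourhoods∩ x~y (inj₁ _)   (inj₂ y≡v) = inj₂ (sym y≡v)
    closedNeighbourhoods∩ x~y (inj₁ x~v) (inj₁ y~v) =
      contradiction x~v (triangleFree x~y y~v)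

    -- A vertex not dominated by A − a lies in N[a] ∩ N[b] ∩ N[q] ∩ N[q′],
    -- so it equals both q and q′.
    over-unique : ∀ {q q′} → IsγSet G A → IsγSet G B → IsγSet G X → IsγSet G Y →
                  Replacement A B a b →
                  Replacement A X a q → a ~ q → q ~ b →
                  Replacement A Y a q′ → a ~ q′ → q′ ~ b → X ≡ Y
    over-unique {A = A} {B = B} {X = X} {Y = Y} {a = a} {b = b} {q} {q′}
      γA (domB , _) (domX , _) (domY , _) rB rX a~q q~b rY a~q′ q′~b
      with q ≟ q′
    ... | yes refl = trans (rX .Replacement.swap) (sym (rY .Replacement.swap))
    ... | no  q≢q′ = contradiction dominates (γSet-minimal γA (rB .Replacement.old))
      where
      a≢b : a ≢ b
      a≢b = ∈∧∉⇒≢ (rB .Replacement.old) (rB .Replacement.new)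

      -- Such a `v` lies in both {a , q} and {q , b}, and `a ≢ b` leaves only `q`.
      collapse : ∀ {q v} → a ~ q → q ~ b → closedNeighbourhood G a v →
                 closedNeighbourhood G b v → closedNeighbourhood G q v → v ≡ q
      collapse a~q q~b na nb nq
        with closedNeighbourhoods∩ a~q na nq | closedNeighbourhoods∩ q~b nq nb
      ... | inj₂ v≡q | _        = v≡q
      ... | inj₁ _   | inj₁ v≡q = v≡q
      ... | inj₁ v≡a | inj₂ v≡b = contradiction (trans (sym v≡a) v≡b) a≢b

      dominates : Dominating G (A - a)
      dominates v
        with dominated-remove a (proj₁ γA v) | dominated-exchange rB (domB v)
           | dominated-exchange rX (domX v)  | dominated-exchange rY (domY v)
      ... | inj₂ d  | _       | _       | _        = d
      ... | inj₁ _  | inj₂ d  | _       | _        = d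
      ... | inj₁ _  | inj₁ _  | inj₂ d  | _        = d
      ... | inj₁ _  | inj₁ _  | inj₁ _  | inj₂ d   = d
      ... | inj₁ na | inj₁ nb | inj₁ nq | inj₁ nq′ = contradiction
        (trans (sym (collapse a~q q~b na nb nq)) (collapse a~q′ q′~b na nb nq′)) q≢q′

    -- A vertex not dominated by A − p lies in N[p] ∩ N[b] = {p , b}, but a dominates p
    -- and p′ dominates b.
    under-unique : ∀ {p p′} → IsγSet G A → IsγSet G X →
                   Replacement A B a b →
                   Replacement A X p b → a ~ p → p ~ b → p ≢ a →
                   Replacement A Y p′ b → p′ ~ b → X ≡ Y
    under-unique {A = A} {X = X} {a = a} {b = b} {p = p} {p′}
      γA (domX , _) rB rX a~p p~b p≢a rY p′~b
      with p ≟ p′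
    ... | yes refl = trans (rX .Replacement.swap) (sym (rY .Replacement.swap))
    ... | no  p≢p′ = contradiction dominates (γSet-minimal γA (rX .Replacement.old))
      where
      dominates : Dominating G (A - p)
      dominates v with dominated-remove p (proj₁ γA v) | dominated-exchange rX (domX v)
      ... | inj₂ d  | _       = d
      ... | inj₁ _  | inj₂ d  = d
      ... | inj₁ np | inj₁ nb with closedNeighbourhoods∩ p~b np nb
      ...   | inj₁ refl = a , x∈p∧x≢y⇒x∈p-y (rB .Replacement.old) (≢-sym p≢a) , inj₁ a~p
      ...   | inj₂ refl = p′ , x∈p∧x≢y⇒x∈p-y (rY .Replacement.old) (≢-sym p≢p′) , inj₁ p′~b

    -- The exchange contains both `A - a` and `B - b′`, so a vertex that it does not dominate must
    -- be near `a` and near `b′`. The diagonal edge `a ~ b′` then leaves two candidates.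
    square-γSet : IsγSet G A → IsγSet G B →
                  Difference₂ A B a a′ → Difference₂ B A b b′ →
                  a ~ b → a ~ b′ → a′ ~ b′ → IsγSet G (A [ a ↦ b ])
    square-γSet {A = A} {B = B} {a = a} {a′ = a′} {b = b} {b′ = b′}
      γA (domB , _) dA dB a~b a~b′ a′~b′ = exchange-γSet γA (dA .a∈A) dominates
      where
      C : Subset n
      C = A [ a ↦ b ]

      from-A : ∀ {v} → closedNeighbourhoodOf G A v →
               closedNeighbourhood G a v ⊎ closedNeighbourhoodOf G C v
      from-A (c , c∈A , near) with c ≟ a
      ... | yes refl = inj₁ near
      ... | no  c≢a  = inj₂ (c , old∈ c∈A c≢a , near)

      from-B : ∀ {v} → closedNeighbourhoodOf G B v →
               closedNeighbourhood G b′ v ⊎ closedNeighbourhoodOf G C v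
      from-B (c , c∈B , near) with dB .cover c∈B
      ... | inj₁ refl        = inj₂ (c , new∈ A a c , near)
      ... | inj₂ (inj₁ refl) = inj₁ near
      ... | inj₂ (inj₂ c∈A)  = inj₂ (c , old∈ c∈A (∈∧∉⇒≢ c∈B (dA .a∉B)) , near)

      -- The remaining vertices lie in N[a] ∩ N[b′] = {a , b′}.
      dominates : Dominating G C
      dominates v with from-A (proj₁ γA v) | from-B (domB v)
      ... | inj₂ d  | _        = d
      ... | inj₁ _  | inj₂ d   = d
      ... | inj₁ na | inj₁ nb′ with closedNeighbourhoods∩ a~b′ na nb′
      ...   | inj₁ refl = b , new∈ A a b , inj₁ (~-sym a~b)
      ...   | inj₂ refl = a′ , old∈ (dA .a′∈A) (≢-sym (dA .a≢a′)) , inj₁ a′~b′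

    -- No two γ-sets have exactly three common neighbours that complete the list of γ-sets.

    module _ {A B : Subset n} {X : Fin 3 → Subset n}
             (γA : IsγSet G A) (γB : IsγSet G B) (γX : ∀ i → IsγSet G (X i))
             (X-injective : Injective _≡_ _≡_ X)
             (complete : ∀ {E} → IsγSet G E → E ≡ A ⊎ E ≡ B ⊎ ∃ λ i → E ≡ X i)
             (between : ∀ i → Between A B (X i)) where

      -- Three sets fall into two kinds, over and under, and each kind admits at most one set.
      ¬replacement : ¬ Replacement A B a b
      ¬replacement {a = a} {b = b} r = <⇒≢ i<j (X-injective (unique (kind i) (kind j) eq))
        where
        -- Unlike `Between`, this fixes the `a` and `b` of `r`, as comparing two sets of one kind
        -- requires; `replacement-unique` justifies it.
        data Kind (Y : Subset n) : Set where
          over  : ∀ {q} → Replacement A Y a q → a ~ q → q ~ b → Kind Y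
          under : ∀ {p} → Replacement A Y p b → a ~ p → p ~ b → p ≢ a → Kind Y

        kind : ∀ i → Kind (X i)
        kind i with between i
        ... | square d _ _ _ _ = contradiction d (¬replacement×difference₂ r)
        ... | over s rX a~q q~b with replacement-unique r s
        ...   | refl , refl = over rX a~q q~b
        kind i | under s rX a~p p~b p≢a with replacement-unique r s
        ...   | refl , refl = under rX a~p p~b p≢a

        code : ∀ {Y} → Kind Y → Fin 2
        code (over _ _ _)    = zero
        code (under _ _ _ _) = suc zero

        unique : ∀ {i j} (k : Kind (X i)) (l : Kind (X j)) → code k ≡ code l → X i ≡ X j
        unique {i} {j} (over rX a~q q~b) (over rY a~q′ q′~b) _ =
          over-unique γA γB (γX i) (γX j) r rX a~q q~b rY a~q′ q′~b
        unique {i} (under rX a~p p~b p≢a) (under rY _ p′~b _) _ =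
          under-unique γA (γX i) r rX a~p p~b p≢a rY p′~b

        collision = pigeonhole (s≤s (s≤s (s≤s z≤n))) (code ∘ kind)
        i = proj₁ collision
        j = proj₁ (proj₂ collision)
        i<j = proj₁ (proj₂ (proj₂ collision))
        eq = proj₂ (proj₂ (proj₂ collision))

      -- All four corners are γ-sets, pairwise distinct and different from `A` and `B`, so they
      -- would have to fit among three X's.
      ¬fourCycle : Difference₂ A B a a′ → Difference₂ B A b b′ →
                   a ~ b → a′ ~ b′ → a ~ b′ → ¬ (a′ ~ b)
      ¬fourCycle {a = a} {a′ = a′} {b = b} {b′ = b′} dA dB a~b a′~b′ a~b′ a′~b =
        <⇒≢ k<l (remQuot-injective (×-≡,≡→≡
          ( pair-injective (dA .a≢a′) (proj₁ same-pair)
          , pair-injective (dB .a≢a′) (proj₂ same-pair))))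
        where
        old new : Fin 2 → Fin n
        old = pair a a′
        new = pair b b′

        old∈A : ∀ i → old i ∈ A
        old∈A zero       = dA .a∈A
        old∈A (suc zero) = dA .a′∈A

        new∉A : ∀ i → new i ∉ A
        new∉A zero       = dB .a∉B
        new∉A (suc zero) = dB .a′∉B

        corner-γSet : ∀ i j → IsγSet G (A [ old i ↦ new j ])
        corner-γSet zero       zero       = square-γSet γA γB dA dB a~b a~b′ a′~b′
        corner-γSet zero       (suc zero) = square-γSet γA γB dA (flip₂ dB) a~b′ a~b a′~b
        corner-γSet (suc zero) zero       = square-γSet γA γB (flip₂ dA) dB a′~b a′~b′ a~b′
        corner-γSet (suc zero) (suc zero) =
          square-γSet γA γB (flip₂ dA) (flip₂ dB) a′~b′ a′~b a~b

        -- `B` contains both `b` and `b′`, whereas a corner contains only one of them; the other one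
        -- tells the corner from `B`.
        other : ∀ j → ∃ λ z → z ∈ B × z ∉ A × z ≢ new j
        other zero       = b′ , dB .a′∈A , dB .a′∉B , ≢-sym (dB .a≢a′)
        other (suc zero) = b , dB .a∈A , dB .a∉B , dB .a≢a′

        index : ∀ i j → ∃ λ k → A [ old i ↦ new j ] ≡ X k
        index i j with complete (corner-γSet i j)
        ... | inj₁ ≡A = contradiction (subst (new j ∈_) ≡A (new∈ A (old i) (new j))) (new∉A j)
        ... | inj₂ (inj₂ found) = found
        ... | inj₂ (inj₁ ≡B) with other j
        ...   | z , z∈B , z∉A , z≢new =
          contradiction (exchange⇒∈ A (old i) (new j) (subst (z ∈_) (sym ≡B) z∈B) z≢new) z∉A

        -- Numbers the corners as a 2 by 2 grid, so that the pigeonhole principle applies to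
        -- `Fin 4`.
        row column : Fin 4 → Fin 2
        row    = quotient 2
        column = remainder {2} 2

        remQuot-injective : ∀ {k l} → (row k , column k) ≡ (row l , column l) → k ≡ l
        remQuot-injective {k} {l} eq =
          trans (sym (combine-remQuot {2} 2 k))
            (trans (cong (λ (i , j) → combine i j) eq) (combine-remQuot {2} 2 l))

        -- Here `ℕ.≤-refl` proves `3 < 4`: four corners, three indices.
        collision = pigeonhole ℕ.≤-refl (λ k → proj₁ (index (row k) (column k)))
        k = proj₁ collision
        l = proj₁ (proj₂ collision)
        k<l = proj₁ (proj₂ (proj₂ collision))
        same = proj₂ (proj₂ (proj₂ collision))

        same-pair : old (row k) ≡ old (row l) × new (column k) ≡ new (column l)
        same-pair = exchange-injective (old∈A (row k)) (new∉A (column k))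
          (old∈A (row l)) (new∉A (column l))
          (trans (proj₂ (index (row k) (column k)))
            (trans (cong X same) (sym (proj₂ (index (row l) (column l))))))

      -- Both A − a + b and A − a′ + b′ come from the matching {ab , a′b′}, so three
      -- X's need the other matching as well.
      ¬difference₂ : Difference₂ A B a a′ → Difference₂ B A b b′ →
                     X zero ≡ A [ a ↦ b ] → a ~ b → ¬ (a′ ~ b′)
      ¬difference₂ {a = a} {a′ = a′} {b = b} {b′ = b′} dA dB X₀≡ a~b a′~b′ =
        conclude (position (suc zero)) (position (suc (suc zero)))
        where
        Position : Fin 3 → Set
        Position i = X i ≡ A [ a ↦ b ] ⊎ X i ≡ A [ a′ ↦ b′ ] ⊎ (a ~ b′ × a′ ~ b)

        position : ∀ i → Position i
        position i with between i
        ... | over r _ _ _    = contradiction r ¬replacement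
        ... | under r _ _ _ _ = contradiction r ¬replacement
        ... | square eA eB X≡ c~d c′~d′
          -- Each pair is named in the same or the opposite order. Reversing both gives the opposite
          -- corner; reversing exactly one yields the edges of the other matching.
          with difference₂-unique dA eA | difference₂-unique dB eB
        ...   | inj₁ (refl , refl) | inj₁ (refl , refl) = inj₁ X≡
        ...   | inj₁ (refl , refl) | inj₂ (refl , refl) = inj₂ (inj₂ (c~d , c′~d′))
        ...   | inj₂ (refl , refl) | inj₁ (refl , refl) = inj₂ (inj₂ (c′~d′ , c~d))
        ...   | inj₂ (refl , refl) | inj₂ (refl , refl) = inj₂ (inj₁ X≡)

        conclude : Position (suc zero) → Position (suc (suc zero)) → ⊥
        conclude (inj₂ (inj₂ (a~b′ , a′~b))) _ = ¬fourCycle dA dB a~b a′~b′ a~b′ a′~b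
        conclude _ (inj₂ (inj₂ (a~b′ , a′~b))) = ¬fourCycle dA dB a~b a′~b′ a~b′ a′~b
        conclude (inj₁ X₁≡) _ = contradiction (X-injective (trans X₀≡ (sym X₁≡))) λ ()
        conclude _ (inj₁ X₂≡) = contradiction (X-injective (trans X₀≡ (sym X₂≡))) λ ()
        conclude (inj₂ (inj₁ X₁≡)) (inj₂ (inj₁ X₂≡)) =
          contradiction (X-injective (trans X₁≡ (sym X₂≡))) λ ()

      ¬between : ⊥
      ¬between with between zero
      ... | over r _ _ _                = ¬replacement r
      ... | under r _ _ _ _             = ¬replacement r
      ... | square dA dB X₀≡ a~b a′~b′ = ¬difference₂ dA dB X₀≡ a~b a′~b′

  -- Transfer along an isomorphism with `K 2 3`.

  isγSet : (D : γSet G) → IsγSet G (value D)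
  isγSet (D , [ γD ]) = recompute (isγSet? G D) γD

  -- Edges of `K 2 3` pull back to slides, and bijectivity makes the five γ-sets distinct and the
  -- only ones.
  triangleFree⇒¬K₂₃ : TriangleFree G → ¬ (γ-graph G ≅ K 2 3)
  triangleFree⇒¬K₂₃ triangleFree iso =
    ¬between triangleFree {X = λ i → vertex (inj₂ i)}
      (isγSet (from (inj₁ zero))) (isγSet (from (inj₁ (suc zero))))
      (λ i → isγSet (from (inj₂ i)))
      (inj₂-injective ∘ vertex-injective)
      complete
      (λ i → slides⇒between A≢B (slide (inj₁ zero) (inj₂ i) tt)
                                 (slide (inj₂ i) (inj₁ (suc zero)) tt))
    where
    open _≅_ iso
    open Inverse bijection using (strictlyInverseˡ; strictlyInverseʳ)
    module K₂₃ = Graph (K 2 3)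

    vertex : Fin 2 ⊎ Fin 3 → Subset n
    vertex s = value (from s)

    value-injective : ∀ {D E : γSet G} → value D ≡ value E → D ≡ E
    value-injective refl = refl

    vertex-injective : Injective _≡_ _≡_ vertex
    vertex-injective {s} {t} eq =
      trans (sym (strictlyInverseˡ s))
        (trans (cong to (value-injective eq)) (strictlyInverseˡ t))

    slide : ∀ s t → s K₂₃.~ t → Slide G (vertex s) (vertex t)
    slide s t s~t = Equivalence.from (adjacency {from s} {from t})
      (subst₂ K₂₃._~_ (sym (strictlyInverseˡ s)) (sym (strictlyInverseˡ t)) s~t)

    A≢B : vertex (inj₁ zero) ≢ vertex (inj₁ (suc zero))
    A≢B eq with () ← vertex-injective eq

    complete : IsγSet G E → E ≡ vertex (inj₁ zero) ⊎ E ≡ vertex (inj₁ (suc zero)) ⊎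
                            ∃ λ i → E ≡ vertex (inj₂ i)
    complete {E} γE with to (E , [ γE ]) | strictlyInverseʳ (E , [ γE ])
    ... | inj₁ zero       | eq = inj₁ (cong value (sym eq))
    ... | inj₁ (suc zero) | eq = inj₂ (inj₁ (cong value (sym eq)))
    ... | inj₂ i          | eq = inj₂ (inj₂ (i , cong value (sym eq)))

theorem6 : ∀ (n : ℕ) (G : Graph (Fin n)) → Bipartite G → ¬ (γ-graph G ≅ K 2 3)
theorem6 n G bipartite = triangleFree⇒¬K₂₃ G (bipartite⇒triangleFree G bipartite)
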